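{- Let $d \ge 1$ and $t \ge 2$ be fixed integers. If $H$ is a fixed $d$-uniform hypergraph with at least two edges in which all edges are pairwise disjoint, then $\operatorname{ex}_{d+1}(n, K_{H,t}) = O(n^{d+1-1/t})$.
   Context: All hypergraphs are finite. A $d$-uniform hypergraph is one all of whose edges are $d$-element subsets of the vertex set (for $d=1$ the edges are singletons). A hypergraph is $H$-free if it contains no (not necessarily induced) subhypergraph isomorphic to $H$. For a $d$-uniform hypergraph $H$, $\operatorname{ex}_d(n,H)$ denotes the maximum number of edges in an $H$-free $d$-uniform hypergraph on $n$ vertices. For a $d$-uniform hypergraph $H$ and a positive integer $t$, $K_{H,t}$ is the $(d+1)$-uniform hypergraph obtained from $H$ by adding $t$ new vertices $v_1,\dots,v_t$ and replacing every edge $e \in E(H)$ with the $t$ edges $e\cup\{v_1\},\dots,e\cup\{v_t\}$. Asymptotic notation is as $n\to\infty$ with $d$, $t$, $H$ fixed; implied constants may depend on these fixed parameters. -}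

module Defs where

open import Data.Bool.Properties using () renaming (_≟_ to _≟ᵇ_)
open import Data.Fin using (Fin; finToFun; funToFin)
open import Data.Fin.Properties using (_≟_; all?; any?; finToFun-funToFin)
open import Data.Fin.Subset using (Subset; inside; outside; ⁅_⁆; _∩_; ∣_∣; Empty)
  renaming (_∈_ to _∈ˢ_)
open import Data.Fin.Subset.Properties using (∣⁅x⁆∣≡1; x∈⁅x⁆; x∈⁅y⁆⇒x≡y)
  renaming (_∈?_ to _∈ˢ?_)
open import Data.List using (List; []; _∷_; _++_; map; filter; length; allFin; cartesianProductWith)
open import Data.List.Extrema.Nat using (max; argmax-sel; xs≤max)
open import Data.List.Membership.Propositional using (_∈_)
open import Data.List.Membership.Propositional.Properties
  using (∈-map⁺; ∈-map⁻; ∈-++⁺ˡ; ∈-++⁺ʳ; ∈-filter⁺; ∈-filter⁻)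
import Data.List.Membership.DecPropositional as DecMembership
open import Data.List.Relation.Binary.Permutation.Propositional.Properties using (↭-length)
open import Data.List.Relation.Binary.BagAndSetEquality using (∼bag⇒↭)
open import Data.List.Membership.Propositional.Properties.WithK using (unique∧set⇒bag)
open import Data.List.Relation.Binary.Sublist.Propositional using (_⊆_; []; _∷_; _∷ʳ_)
open import Data.List.Relation.Binary.Sublist.Propositional.Properties
  using (All-resp-⊆; filter-⊆)
open import Data.List.Relation.Unary.All as All using (All)
open import Data.List.Relation.Unary.All.Properties using (all-filter; cartesianProductWith⁺)
open import Data.List.Relation.Unary.AllPairs using ([]; _∷_)
open import Data.List.Relation.Unary.Any using (here)
open import Data.List.Relation.Unary.Unique.Propositional using (Unique)
import Data.List.Relation.Unary.Unique.Propositional.Properties as Unique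
open import Data.Nat using (ℕ; zero; suc; _+_; _*_; _^_; _≤_)
open import Data.Nat.Properties as ℕ using (+-comm)
open import Data.Product using (∃; ∃-syntax; _×_; _,_; proj₁; proj₂)
open import Data.Sum using (inj₁; inj₂)
open import Data.Vec as Vec using ([]; _∷_; tabulate)
open import Data.Vec.Properties using (≡-dec; ++-injective; tabulate-cong)
open import Function using (_∘_; mk⇔)
open import Function.Definitions using (Injective)
open import Relation.Binary.PropositionalEquality
  using (_≡_; _≢_; _≗_; refl; sym; trans; cong; subst; setoid)
open import Relation.Nullary using (¬_; Dec; does; ¬?)
open import Relation.Nullary.Decidable using (map′; _×-dec_; _→-dec_; does-⇔)

-- A d-uniform hypergraph on the vertex set Fin n.  The list `edges` stands for
-- a set, so its length is the number of edges.
record Hypergraph (d n : ℕ) : Set where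
  field
    edges   : List (Subset n)
    unique  : Unique edges
    uniform : All (λ e → ∣ e ∣ ≡ d) edges

open Hypergraph public

size : ∀ {d n} → Hypergraph d n → ℕ
size G = length (edges G)

PairwiseDisjoint : ∀ {d n} → Hypergraph d n → Set
PairwiseDisjoint G = ∀ {e e′} → e ∈ edges G → e′ ∈ edges G → e ≢ e′ → Empty (e ∩ e′)

preimage? : ∀ {m n} (f : Fin m → Fin n) e j → Dec (∃ λ i → i ∈ˢ e × f i ≡ j)
preimage? f e j = any? λ i → (i ∈ˢ? e) ×-dec (f i ≟ j)

image : ∀ {m n} → (Fin m → Fin n) → Subset m → Subset n
image f e = tabulate λ j → does (preimage? f e j)

-- f identifies F with a subhypergraph of G, not necessarily an induced one.
IsEmbedding : ∀ {d m n} → Hypergraph d m → Hypergraph d n → (Fin m → Fin n) → Set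
IsEmbedding F G f = Injective _≡_ _≡_ f × All (λ e → image f e ∈ edges G) (edges F)

Free : ∀ {d m n} → Hypergraph d m → Hypergraph d n → Set
Free F G = ¬ ∃ (IsEmbedding F G)

------------------------------------------------------------------------
-- K_{H,t}: the old vertices are the first v elements of Fin (v + t), the new
-- ones the last t.

private
  ∣++∣ : ∀ {m n} (p : Subset m) (q : Subset n) → ∣ p Vec.++ q ∣ ≡ ∣ p ∣ + ∣ q ∣
  ∣++∣ []            q = refl
  ∣++∣ (inside  ∷ p) q = cong suc (∣++∣ p q)
  ∣++∣ (outside ∷ p) q = ∣++∣ p q

  ⁅⁆-injective : ∀ {n} {i j : Fin n} → ⁅ i ⁆ ≡ ⁅ j ⁆ → i ≡ j
  ⁅⁆-injective {i = i} {j} eq = x∈⁅y⁆⇒x≡y j (subst (i ∈ˢ_) eq (x∈⁅x⁆ i))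

K : ∀ {d v} → Hypergraph d v → (t : ℕ) → Hypergraph (suc d) (v + t)
K {d} {v} H t = record
  { edges   = cartesianProductWith _∪new_ (edges H) (allFin t)
  ; unique  = Unique.cartesianProductWith⁺ _∪new_ injective (unique H) (Unique.allFin⁺ t)
  ; uniform = cartesianProductWith-All (edges H) (uniform H)
  }
  where
  _∪new_ : Subset v → Fin t → Subset (v + t)
  e ∪new i = e Vec.++ ⁅ i ⁆

  injective : ∀ {e e′ i i′} → e ∪new i ≡ e′ ∪new i′ → e ≡ e′ × i ≡ i′
  injective {e} {e′} eq with ++-injective e e′ eq
  ... | e≡e′ , i≡i′ = e≡e′ , ⁅⁆-injective i≡i′

  ∣∪new∣ : ∀ e i → ∣ e ∣ ≡ d → ∣ e ∪new i ∣ ≡ suc d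
  ∣∪new∣ e i refl =
    trans (∣++∣ e ⁅ i ⁆) (trans (cong (∣ e ∣ +_) (∣⁅x⁆∣≡1 i)) (+-comm ∣ e ∣ 1))

  cartesianProductWith-All : ∀ es → All (λ e → ∣ e ∣ ≡ d) es →
    All (λ e → ∣ e ∣ ≡ suc d) (cartesianProductWith _∪new_ es (allFin t))
  cartesianProductWith-All es us =
    cartesianProductWith⁺ (setoid _) (setoid _) _∪new_ es (allFin t)
      λ {e} {i} e∈es _ → ∣∪new∣ e i (All.lookup us e∈es)

------------------------------------------------------------------------
-- The extremal number is the maximum over an explicit list of all d-uniform
-- hypergraphs on Fin n.

subsets : ∀ n → List (Subset n)
subsets zero    = [] ∷ []
subsets (suc n) = map (inside ∷_) (subsets n) ++ map (outside ∷_) (subsets n)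

sublists : ∀ {A : Set} (xs : List A) → List (∃ (_⊆ xs))
sublists []       = ([] , []) ∷ []
sublists (x ∷ xs) =
  map (λ (ys , τ) → x ∷ ys , refl ∷ τ) (sublists xs) ++
  map (λ (ys , τ) → ys , x ∷ʳ τ) (sublists xs)

private
  Unique-resp-⊆ : ∀ {A : Set} {xs ys : List A} → xs ⊆ ys → Unique ys → Unique xs
  Unique-resp-⊆ []         []       = []
  Unique-resp-⊆ (_ ∷ʳ τ)   (_ ∷ u)  = Unique-resp-⊆ τ u
  Unique-resp-⊆ (refl ∷ τ) (y∉ ∷ u) = All-resp-⊆ τ y∉ ∷ Unique-resp-⊆ τ u

  subsets-unique : ∀ n → Unique (subsets n)
  subsets-unique zero    = All.[] ∷ []
  subsets-unique (suc n) =
    Unique.++⁺ (Unique.map⁺ (cong Vec.tail) (subsets-unique n))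
               (Unique.map⁺ (cong Vec.tail) (subsets-unique n))
               disjoint
    where
    disjoint : ∀ {p} → ¬ (p ∈ map (inside ∷_) (subsets n) × p ∈ map (outside ∷_) (subsets n))
    disjoint (p∈ , p∈′) with ∈-map⁻ _ p∈ | ∈-map⁻ _ p∈′
    ... | _ , _ , refl | _ , _ , ()

  ∈-subsets : ∀ {n} (p : Subset n) → p ∈ subsets n
  ∈-subsets []            = here refl
  ∈-subsets (inside  ∷ p) = ∈-++⁺ˡ (∈-map⁺ _ (∈-subsets p))
  ∈-subsets (outside ∷ p) = ∈-++⁺ʳ _ (∈-map⁺ _ (∈-subsets p))

  ∈-sublists : ∀ {A : Set} {xs ys : List A} (τ : ys ⊆ xs) → (ys , τ) ∈ sublists xs
  ∈-sublists []         = here refl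
  ∈-sublists (x ∷ʳ τ)   = ∈-++⁺ʳ _ (∈-map⁺ _ (∈-sublists τ))
  ∈-sublists (refl ∷ τ) = ∈-++⁺ˡ (∈-map⁺ _ (∈-sublists τ))

uniformSubsets : ∀ d n → List (Subset n)
uniformSubsets d n = filter (λ e → ∣ e ∣ ℕ.≟ d) (subsets n)

fromSublist : ∀ {d n} → ∃ (_⊆ uniformSubsets d n) → Hypergraph d n
fromSublist {d} {n} (es , τ) = record
  { edges   = es
  ; unique  = Unique-resp-⊆ τ (Unique.filter⁺ (λ e → ∣ e ∣ ℕ.≟ d) (subsets-unique n))
  ; uniform = All-resp-⊆ τ (all-filter (λ e → ∣ e ∣ ℕ.≟ d) (subsets n))
  }

hypergraphs : ∀ d n → List (Hypergraph d n)
hypergraphs d n = map fromSublist (sublists (uniformSubsets d n))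

private
  module _ {n : ℕ} where
    open DecMembership (≡-dec {n = n} _≟ᵇ_) public using () renaming (_∈?_ to _∈ᴱ?_)

  image-cong : ∀ {m n} {f g : Fin m → Fin n} → f ≗ g → ∀ e → image f e ≡ image g e
  image-cong {f = f} {g} f≗g e = tabulate-cong λ j →
    does-⇔ (mk⇔ (λ (i , i∈ , eq) → i , i∈ , trans (sym (f≗g i)) eq)
                (λ (i , i∈ , eq) → i , i∈ , trans (f≗g i) eq))
           (preimage? f e j) (preimage? g e j)

  embedding-cong : ∀ {d m n} (F : Hypergraph d m) (G : Hypergraph d n) {f g} → f ≗ g →
                   IsEmbedding F G f → IsEmbedding F G g
  embedding-cong F G f≗g (inj , emb) =
    (λ {i} {j} eq → inj (trans (f≗g i) (trans eq (sym (f≗g j))))) ,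
    All.map (λ {e} → subst (_∈ edges G) (image-cong f≗g e)) emb

embedding? : ∀ {d m n} (F : Hypergraph d m) (G : Hypergraph d n) f → Dec (IsEmbedding F G f)
embedding? F G f =
  map′ (λ inj {i} {j} → inj i j) (λ inj i j → inj {i} {j})
       (all? λ i → all? λ j → (f i ≟ f j) →-dec (i ≟ j))
  ×-dec All.all? (λ e → image f e ∈ᴱ? edges G) (edges F)

free? : ∀ {d m n} (F : Hypergraph d m) (G : Hypergraph d n) → Dec (Free F G)
free? F G = ¬? (map′
  (λ (k , emb) → finToFun k , emb)
  (λ (f , emb) → funToFin f , embedding-cong F G (sym ∘ finToFun-funToFin f) emb)
  (any? λ k → embedding? F G (finToFun k)))

-- The value is 0 when there is no F-free hypergraph on n vertices at all, which
-- requires F to be edgeless.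
ex : ∀ {d m} → ℕ → Hypergraph d m → ℕ
ex {d} n F = max 0 (map size (filter (free? F) (hypergraphs d n)))

private
  enumerated : ∀ {d n} (G : Hypergraph d n) →
    ∃[ G′ ] G′ ∈ hypergraphs d n × size G′ ≡ size G × (∀ {e} → e ∈ edges G′ → e ∈ edges G)
  enumerated {d} {n} G =
    G′ , ∈-map⁺ fromSublist (∈-sublists τ) ,
    ↭-length (∼bag⇒↭ (unique∧set⇒bag (unique G′) (unique G) (mk⇔ to from))) , to
    where
    τ : filter (_∈ᴱ? edges G) (uniformSubsets d n) ⊆ uniformSubsets d n
    τ = filter-⊆ (_∈ᴱ? edges G) (uniformSubsets d n)

    G′ : Hypergraph d n
    G′ = fromSublist (_ , τ)

    to : ∀ {e} → e ∈ edges G′ → e ∈ edges G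
    to = proj₂ ∘ ∈-filter⁻ (_∈ᴱ? edges G) {xs = uniformSubsets d n}

    from : ∀ {e} → e ∈ edges G → e ∈ edges G′
    from {e} e∈G = ∈-filter⁺ (_∈ᴱ? edges G)
      (∈-filter⁺ (λ e → ∣ e ∣ ℕ.≟ d) (∈-subsets e) (All.lookup (uniform G) e∈G)) e∈G

ex-upper : ∀ {d m n} (F : Hypergraph d m) (G : Hypergraph d n) → Free F G → size G ≤ ex n F
ex-upper {d} {n = n} F G free with enumerated G
... | G′ , G′∈ , size≡ , G′⊆G =
  subst (_≤ ex n F) size≡
    (All.lookup (xs≤max 0 _)
      (∈-map⁺ size (∈-filter⁺ (free? F) G′∈
        λ (f , inj , emb) → free (f , inj , All.map G′⊆G emb))))

ex-attained : ∀ {d m n} (F : Hypergraph d m) → ∃ (λ (G : Hypergraph d n) → Free F G) →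
              ∃[ G ] Free {n = n} F G × size G ≡ ex n F
ex-attained {d} {n = n} F (G₀ , free₀)
  with argmax-sel (λ k → k) 0 (map size (filter (free? F) (hypergraphs d n)))
... | inj₁ ex≡0 = G₀ , free₀ ,
      trans (ℕ.n≤0⇒n≡0 (subst (size G₀ ≤_) ex≡0 (ex-upper F G₀ free₀))) (sym ex≡0)
... | inj₂ ex∈ with ∈-map⁻ size ex∈
...   | G , G∈ , ex≡ = G , proj₂ (∈-filter⁻ (free? F) {xs = hypergraphs d n} G∈) , sym ex≡

-- g =O[n^ p / q ] says g(n) = O(n^(p/q)) for q ≥ 1: the inequality
-- g n ≤ C · n^(p/q) raised to the q-th power.  A natural C loses nothing, since
-- a real constant can be rounded up.
_=O[n^_/_] : (ℕ → ℕ) → ℕ → ℕ → Set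
g =O[n^ p / q ] = ∃[ C ] ∃[ n₀ ] ∀ n → n₀ ≤ n → g n ^ q ≤ C ^ q * n ^ p

{-# OPTIONS --safe #-}

-- Let n be large and G be K_{H,t}-free.  Sum deg(e)^t over the d-sets e in the shadow of G,
-- where deg(e) counts the vertices extending e to an edge.  This sum counts pairs (e, T)
-- with T a t-tuple of vertices each extending e.  If the entries of T are distinct, more
-- than a constant times n^(d-1) sets e belonging to T would allow a greedy copy of H among
-- them, since only that many d-sets meet a bounded set of vertices; together with T this
-- copy is a K_{H,t}.  Only O(n^(t-1)) tuples T have a repeated entry, and each of them has
-- at most n^d sets e.  So the sum is O(n^(t+d-1)), and the power mean inequality over the
-- at most n^d sets e turns this into |G|^t = O(n^(d(t-1)) n^(t+d-1)) = O(n^((d+1)t-1)).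
module Submission where

open import Defs
open import Data.Bool using (true; false; if_then_else_)
open import Data.Bool.Properties using () renaming (_≟_ to _≟ᵇ_)
open import Data.Fin using (Fin; zero; suc; _↑ˡ_; _↑ʳ_; splitAt; inject≤)
open import Data.Fin.Permutation.Components using (transpose; transpose-inverse)
open import Data.Fin.Properties
  using (_≟_; suc-injective; ↑ˡ-injective; ↑ʳ-injective; splitAt⁻¹-↑ˡ; splitAt⁻¹-↑ʳ;
         splitAt-↑ˡ; splitAt-↑ʳ; inject≤-injective)
open import Data.Fin.Subset
  using (Subset; inside; outside; ⁅_⁆; _∪_; _-_; ∣_∣; Empty; Nonempty)
  renaming (_∈_ to _∈ˢ_; _∉_ to _∉ˢ_)
open import Data.Fin.Subset.Properties
  using (p─⊥≡p; ∪-identityʳ; Empty-unique; nonempty?; ∣⊥∣≡0; x∈⁅x⁆; x∈⁅y⁆⇒x≡y;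
         x∈p∪q⁻; x∈p∪q⁺; x∈p∩q⁺; ⊆-antisym)
  renaming (_∈?_ to _∈ˢ?_)
open import Data.List
  using (List; []; _∷_; _++_; map; filter; length; zip; allFin; cartesianProduct;
         cartesianProductWith; deduplicate)
open import Data.List.Extrema.Nat using (argmax-all)
import Data.List.Membership.DecPropositional as DecMembership
open import Data.List.Membership.Propositional using (_∈_; _∉_; find; lose)
open import Data.List.Membership.Propositional.Properties
  using (∈-allFin; ∈-map⁺; ∈-map⁻; ∈-++⁺ˡ; ∈-++⁺ʳ; ∈-++⁻; ∈-filter⁺; ∈-filter⁻; ∈-deduplicate⁺;
         ∈-cartesianProduct⁺; ∈-cartesianProductWith⁺; ∈-cartesianProductWith⁻)
open import Data.List.Properties
  using (map-cong; map-++; map-∘; length-map; length-++; length-filter; length-tabulate)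
open import Data.List.Relation.Binary.Disjoint.Propositional using (Disjoint)
open import Data.List.Relation.Binary.Subset.Propositional using (_⊆_)
open import Data.List.Relation.Unary.All as All using (All; []; _∷_)
import Data.List.Relation.Unary.All.Properties as All
open import Data.List.Relation.Unary.AllPairs as AllPairs using (AllPairs; []; _∷_)
import Data.List.Relation.Unary.AllPairs.Properties as AllPairs
open import Data.List.Relation.Unary.Any as Any using (here; there)
open import Data.List.Relation.Unary.Unique.DecPropositional.Properties using (deduplicate-!)
open import Data.List.Relation.Unary.Unique.Propositional using (Unique)
import Data.List.Relation.Unary.Unique.Propositional.Properties as Unique
open import Data.Nat
  using (ℕ; zero; suc; _+_; _*_; _^_; _∸_; _≤_; _<_; z≤n; s≤s; >-nonZero)
open import Data.Nat.ListAction using (sum)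
open import Data.Nat.ListAction.Properties using (sum-++)
import Data.Nat.Properties as ℕ
open import Data.Nat.Properties hiding (_≟_; suc-injective)
open import Data.Nat.Tactic.RingSolver using (solve-∀)
open import Data.Product using (∃-syntax; _×_; _,_; proj₁; proj₂)
open import Data.Sum using (_⊎_; inj₁; inj₂; [_,_]′; swap)
open import Data.Vec as Vec using (Vec; []; _∷_; here; there)
open import Data.Vec.Membership.Propositional.Properties using (∈-lookup)
open import Data.Vec.Properties
  using (≡-dec; lookup⇒[]=; []=⇒lookup; lookup-++ˡ; lookup-++ʳ; lookup∘tabulate)
import Data.Vec.Relation.Unary.All as VecAll
import Data.Vec.Relation.Unary.AllPairs as VecPairs
import Data.Vec.Relation.Unary.Any as VecAny
import Data.Vec.Relation.Unary.Unique.Propositional as VecUnique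
open import Data.Vec.Relation.Unary.Unique.Propositional.Properties using (lookup-injective)
open import Function using (_∘_)
open import Function.Definitions using (Injective)
open import Level using (0ℓ)
open import Relation.Binary.PropositionalEquality
open import Relation.Nullary using (¬_; Dec; does; yes; no; ¬?; contradiction)
open import Relation.Nullary.Decidable using (_×-dec_; dec-true; dec-false; toSum)
open import Relation.Unary using (Pred; Decidable)

private variable
  A B C : Set

-- Finite sums and the power mean inequality.

∑ : List A → (A → ℕ) → ℕ
∑ xs f = sum (map f xs)

∑-mono : ∀ {f g : A → ℕ} xs → (∀ {x} → x ∈ xs → f x ≤ g x) → ∑ xs f ≤ ∑ xs g
∑-mono []       f≤g = z≤n
∑-mono (x ∷ xs) f≤g = +-mono-≤ (f≤g (here refl)) (∑-mono xs (f≤g ∘ there))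

∑-cong : ∀ {f g : A → ℕ} → f ≗ g → ∀ xs → ∑ xs f ≡ ∑ xs g
∑-cong f≗g xs = cong sum (map-cong f≗g xs)

∑-const : ∀ (xs : List A) c → ∑ xs (λ _ → c) ≡ length xs * c
∑-const []       c = refl
∑-const (x ∷ xs) c = cong (c +_) (∑-const xs c)

length≡∑ : ∀ (xs : List A) → length xs ≡ ∑ xs (λ _ → 1)
length≡∑ xs = sym (trans (∑-const xs 1) (*-identityʳ (length xs)))

∑-+ : ∀ xs (f g : A → ℕ) → ∑ xs (λ x → f x + g x) ≡ ∑ xs f + ∑ xs g
∑-+ []       f g = refl
∑-+ (x ∷ xs) f g = trans (cong (f x + g x +_) (∑-+ xs f g)) (interchange (f x) (g x) _ _)
  where
  interchange : ∀ a b c d → (a + b) + (c + d) ≡ (a + c) + (b + d)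
  interchange = solve-∀

*-∑ : ∀ c xs (f : A → ℕ) → c * ∑ xs f ≡ ∑ xs (λ x → c * f x)
*-∑ c []       f = *-zeroʳ c
*-∑ c (x ∷ xs) f = trans (*-distribˡ-+ c (f x) _) (cong (c * f x +_) (*-∑ c xs f))

∑-* : ∀ xs (f : A → ℕ) c → ∑ xs f * c ≡ ∑ xs (λ x → f x * c)
∑-* []       f c = refl
∑-* (x ∷ xs) f c = trans (*-distribʳ-+ c (f x) _) (cong (f x * c +_) (∑-* xs f c))

∑-swap : ∀ xs ys (f : A → B → ℕ) → ∑ xs (λ x → ∑ ys (f x)) ≡ ∑ ys (λ y → ∑ xs (λ x → f x y))
∑-swap []       ys f = sym (trans (∑-const ys 0) (*-zeroʳ (length ys)))
∑-swap (x ∷ xs) ys f = trans (cong (∑ ys (f x) +_) (∑-swap xs ys f)) (sym (∑-+ ys (f x) _))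

∑-cartesianProductWith : ∀ (f : A → B → C) xs ys g →
  ∑ (cartesianProductWith f xs ys) g ≡ ∑ xs (λ x → ∑ ys (λ y → g (f x y)))
∑-cartesianProductWith f []       ys g = refl
∑-cartesianProductWith f (x ∷ xs) ys g = begin
  sum (map g (map (f x) ys ++ cartesianProductWith f xs ys))
    ≡⟨ cong sum (map-++ g (map (f x) ys) _) ⟩
  sum (map g (map (f x) ys) ++ map g (cartesianProductWith f xs ys))
    ≡⟨ sum-++ (map g (map (f x) ys)) _ ⟩
  sum (map g (map (f x) ys)) + ∑ (cartesianProductWith f xs ys) g
    ≡⟨ cong₂ _+_ (cong sum (sym (map-∘ ys))) (∑-cartesianProductWith f xs ys g) ⟩
  ∑ ys (λ y → g (f x y)) + ∑ xs (λ x → ∑ ys (λ y → g (f x y))) ∎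
  where open ≡-Reasoning

-- The right side exceeds the left by exactly `(b ∸ a) * (q ∸ p)`. Writing `b` and `q` as `a` and
-- `p` plus these differences turns the claim into a semiring identity.
rearrangement : ∀ {a b p q} → a ≤ b → p ≤ q → a * q + b * p ≤ a * p + b * q
rearrangement {a} {b} {p} {q} a≤b p≤q = begin
  a * q + b * p                              ≡⟨ cong₂ (λ b q → a * q + b * p) (m+[n∸m]≡n a≤b) (m+[n∸m]≡n p≤q) ⟨
  a * (p + (q ∸ p)) + (a + (b ∸ a)) * p      ≤⟨ m≤m+n _ _ ⟩
  a * (p + (q ∸ p)) + (a + (b ∸ a)) * p + (b ∸ a) * (q ∸ p) ≡⟨ expand a p (b ∸ a) (q ∸ p) ⟩
  a * p + (a + (b ∸ a)) * (p + (q ∸ p))      ≡⟨ cong₂ (λ b q → a * p + b * q) (m+[n∸m]≡n a≤b) (m+[n∸m]≡n p≤q) ⟩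
  a * p + b * q                              ∎
  where
  open ≤-Reasoning
  expand : ∀ a p c d → a * (p + d) + (a + c) * p + c * d ≡ a * p + (a + c) * (p + d)
  expand = solve-∀

-- Taking powers is monotone, so `a , b` and `a ^ k , b ^ k` are ordered alike and `rearrangement`
-- applies in either order of `a` and `b`.
mixed-powers : ∀ a b k → a * b ^ k + b * a ^ k ≤ a ^ suc k + b ^ suc k
mixed-powers a b k with ≤-total a b
... | inj₁ a≤b = rearrangement a≤b (^-monoˡ-≤ k a≤b)
... | inj₂ b≤a = subst₂ _≤_ (+-comm (b * a ^ k) _) (+-comm (b ^ suc k) _)
                   (rearrangement b≤a (^-monoˡ-≤ k b≤a))

-- This is Chebyshev's sum inequality for the similarly ordered sequences `f` and `f ^ k`. In the
-- induction, the cross terms between the new entry and each old one are bounded by `mixed-powers`.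
chebyshev : ∀ xs (f : A → ℕ) k →
  ∑ xs f * ∑ xs (λ x → f x ^ k) ≤ length xs * ∑ xs (λ x → f x ^ suc k)
chebyshev []       f k = z≤n
chebyshev (x ∷ xs) f k = begin
  (a + S₁) * (a ^ k + Sₖ)
    ≡⟨ expandˡ a S₁ (a ^ k) Sₖ ⟩
  a ^ suc k + (a * Sₖ + S₁ * a ^ k) + S₁ * Sₖ
    ≡⟨ cong (λ s → a ^ suc k + s + S₁ * Sₖ)
         (trans (cong₂ _+_ (*-∑ a xs _) (∑-* xs f (a ^ k))) (sym (∑-+ xs _ _))) ⟩
  a ^ suc k + ∑ xs (λ y → a * f y ^ k + f y * a ^ k) + S₁ * Sₖ
    ≤⟨ +-mono-≤ (+-monoʳ-≤ (a ^ suc k) (∑-mono xs λ {y} _ → mixed-powers a (f y) k)) (chebyshev xs f k) ⟩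
  a ^ suc k + ∑ xs (λ y → a ^ suc k + f y ^ suc k) + N * Sₖ₊₁
    ≡⟨ cong (λ s → a ^ suc k + s + N * Sₖ₊₁)
         (trans (∑-+ xs _ _) (cong (_+ Sₖ₊₁) (∑-const xs (a ^ suc k)))) ⟩
  a ^ suc k + (N * a ^ suc k + Sₖ₊₁) + N * Sₖ₊₁
    ≡⟨ expandʳ (a ^ suc k) N Sₖ₊₁ ⟩
  suc N * (a ^ suc k + Sₖ₊₁) ∎
  where
  open ≤-Reasoning
  a    = f x
  N    = length xs
  S₁   = ∑ xs f
  Sₖ   = ∑ xs (λ y → f y ^ k)
  Sₖ₊₁ = ∑ xs (λ y → f y ^ suc k)
  expandˡ : ∀ a s p q → (a + s) * (p + q) ≡ a * p + (a * q + s * p) + s * q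
  expandˡ = solve-∀
  expandʳ : ∀ p n s → p + (n * p + s) + n * s ≡ suc n * (p + s)
  expandʳ = solve-∀

-- Each further factor `∑ xs f` is absorbed into the sum of powers by `chebyshev`, at the price of
-- one factor `length xs`.
power-mean : ∀ xs (f : A → ℕ) k → ∑ xs f ^ suc k ≤ length xs ^ k * ∑ xs (λ x → f x ^ suc k)
power-mean xs f zero = ≤-reflexive (begin
  ∑ xs f * 1                   ≡⟨ *-comm (∑ xs f) 1 ⟩
  1 * ∑ xs f                   ≡⟨ cong (1 *_) (∑-cong (sym ∘ *-identityʳ ∘ f) xs) ⟩
  1 * ∑ xs (λ x → f x * 1)     ∎)
  where open ≡-Reasoning
power-mean xs f (suc k) = begin
  S₁ * S₁ ^ suc k        ≤⟨ *-monoʳ-≤ S₁ (power-mean xs f k) ⟩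
  S₁ * (N ^ k * S (suc k)) ≡⟨ exchange S₁ (N ^ k) _ ⟩
  N ^ k * (S₁ * S (suc k)) ≤⟨ *-monoʳ-≤ (N ^ k) (chebyshev xs f (suc k)) ⟩
  N ^ k * (N * S (2 + k))  ≡⟨ collect (N ^ k) N _ ⟩
  N ^ suc k * S (2 + k)  ∎
  where
  open ≤-Reasoning
  N    = length xs
  S₁   = ∑ xs f
  S : ℕ → ℕ
  S k = ∑ xs (λ y → f y ^ k)
  exchange : ∀ a b c → a * (b * c) ≡ b * (a * c)
  exchange = solve-∀
  collect : ∀ a b c → a * (b * c) ≡ b * a * c
  collect = solve-∀

-- Indicators and double counting.

𝟙 : ∀ {P : Set} → Dec P → ℕ
𝟙 P? = if does P? then 1 else 0

𝟙-⊎ : ∀ {P Q R : Set} (P? : Dec P) (Q? : Dec Q) (R? : Dec R) →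
      (P → Q ⊎ R) → 𝟙 P? ≤ 𝟙 Q? + 𝟙 R?
𝟙-⊎ (no _)  _        _        _ = z≤n
𝟙-⊎ (yes _) (yes _)  _        _ = s≤s z≤n
𝟙-⊎ (yes _) (no _)   (yes _)  _ = ≤-refl
𝟙-⊎ (yes p) (no ¬q)  (no ¬r)  f = contradiction (f p) [ ¬q , ¬r ]′

count : ∀ {P : Pred A 0ℓ} → Decidable P → List A → ℕ
count P? xs = length (filter P? xs)

count≡∑ : ∀ {P : Pred A 0ℓ} (P? : Decidable P) xs → count P? xs ≡ ∑ xs (𝟙 ∘ P?)
count≡∑ P? []       = refl
count≡∑ P? (x ∷ xs) with does (P? x)
... | true  = cong suc (count≡∑ P? xs)
... | false = count≡∑ P? xs

∑-count : ∀ {Q : A → B → Set} (Q? : ∀ x y → Dec (Q x y)) xs ys →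
  ∑ xs (λ x → count (Q? x) ys) ≡ ∑ ys (λ y → count (λ x → Q? x y) xs)
∑-count Q? xs ys = begin
  ∑ xs (λ x → count (Q? x) ys)             ≡⟨ ∑-cong (λ x → count≡∑ (Q? x) ys) xs ⟩
  ∑ xs (λ x → ∑ ys (λ y → 𝟙 (Q? x y)))     ≡⟨ ∑-swap xs ys _ ⟩
  ∑ ys (λ y → ∑ xs (λ x → 𝟙 (Q? x y)))     ≡⟨ ∑-cong (λ y → count≡∑ (λ x → Q? x y) xs) ys ⟨
  ∑ ys (λ y → count (λ x → Q? x y) xs)     ∎
  where open ≡-Reasoning

1≤count : ∀ {P : Pred A 0ℓ} (P? : Decidable P) {x xs} → x ∈ xs → P x → 1 ≤ count P? xs
1≤count P? {xs = x ∷ xs} (here refl) px with P? x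
... | yes _  = s≤s z≤n
... | no ¬px = contradiction px ¬px
1≤count P? {xs = y ∷ xs} (there x∈) px with does (P? y)
... | true  = s≤s z≤n
... | false = 1≤count P? x∈ px

-- Double counting of the pairs in `Q`: every `x` has a partner in `ys`, so it is counted at least
-- once on the right.
length≤∑count : ∀ {Q : A → B → Set} (Q? : ∀ x y → Dec (Q x y)) xs ys →
  (∀ {x} → x ∈ xs → ∃[ y ] y ∈ ys × Q x y) → length xs ≤ ∑ ys (λ y → count (λ x → Q? x y) xs)
length≤∑count Q? xs ys covered = begin
  length xs                          ≡⟨ length≡∑ xs ⟩
  ∑ xs (λ _ → 1)                     ≤⟨ ∑-mono xs (λ x∈ → let _ , y∈ , q = covered x∈ in 1≤count (Q? _) y∈ q) ⟩
  ∑ xs (λ x → count (Q? x) ys)       ≡⟨ ∑-count Q? xs ys ⟩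
  ∑ ys (λ y → count (λ x → Q? x y) xs) ∎
  where open ≤-Reasoning

-- A list without duplicates holds at most one solution of `P`, and if it holds one, then `Z` is
-- true.
count≤𝟙 : ∀ {P : Pred A 0ℓ} {Z : Set} (P? : Decidable P) (Z? : Dec Z) {xs} → Unique xs →
  (∀ {x y} → P x → P y → x ≡ y) → (∀ {x} → x ∈ xs → P x → Z) → count P? xs ≤ 𝟙 Z?
count≤𝟙 {P = P} {Z = Z} P? Z? {xs} xs! P-unique P⇒Z =
  bound (filter P? xs) (Unique.filter⁺ P? xs!) (proj₂ ∘ ∈-filter⁻ P? {xs = xs})
    (λ x∈ → let x∈xs , px = ∈-filter⁻ P? {xs = xs} x∈ in P⇒Z x∈xs px) Z?
  where
  bound : ∀ ys → Unique ys → (∀ {x} → x ∈ ys → P x) → (∀ {x} → x ∈ ys → Z) → (Z? : Dec Z) → length ys ≤ 𝟙 Z?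
  bound []           _                 _  _ _       = z≤n
  bound (y ∷ [])     _                 _  z (yes _) = ≤-refl
  bound (y ∷ _)      _                 _  z (no ¬z) = contradiction (z (here refl)) ¬z
  bound (y ∷ y′ ∷ _) ((y≢y′ ∷ _) ∷ _)  p  _ _       =
    contradiction (P-unique (p (here refl)) (p (there (here refl)))) y≢y′

count≤1 : ∀ {P : Pred A 0ℓ} (P? : Decidable P) {xs} → Unique xs → (∀ {x y} → P x → P y → x ≡ y) → count P? xs ≤ 1
count≤1 P? xs! P-unique = count≤𝟙 P? (yes refl) xs! P-unique λ _ _ → refl {x = 0}

-- Tuples and the Kővári-Sós-Turán double count.

tuples : ∀ k → List A → List (Vec A k)
tuples zero    xs = [] ∷ []
tuples (suc k) xs = cartesianProductWith _∷_ xs (tuples k xs)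

length-tuples : ∀ k (xs : List A) → length (tuples k xs) ≡ length xs ^ k
length-tuples zero    xs = refl
length-tuples (suc k) xs =
  begin
  length (tuples (suc k) xs)                ≡⟨ length≡∑ (tuples (suc k) xs) ⟩
  ∑ (tuples (suc k) xs) (λ _ → 1)           ≡⟨ ∑-cartesianProductWith _∷_ xs (tuples k xs) _ ⟩
  ∑ xs (λ _ → ∑ (tuples k xs) (λ _ → 1))    ≡⟨ ∑-const xs _ ⟩
  length xs * ∑ (tuples k xs) (λ _ → 1)     ≡⟨ cong (length xs *_) (length≡∑ (tuples k xs)) ⟨
  length xs * length (tuples k xs)          ≡⟨ cong (length xs *_) (length-tuples k xs) ⟩
  length xs ^ suc k                         ∎
  where
  open ≡-Reasoning

-- Choosing `k` solutions independently, repetitions allowed, is choosing a tuple of solutions. This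
-- turns a power of a degree into a number of tuples.
count-^ : ∀ {P : Pred A 0ℓ} (P? : Decidable P) k xs → count P? xs ^ k ≡ count (VecAll.all? P?) (tuples k xs)
count-^ P? zero    xs = refl
count-^ P? (suc k) xs = begin
  count P? xs * count P? xs ^ k
    ≡⟨ cong₂ _*_ (count≡∑ P? xs) (trans (count-^ P? k xs) (count≡∑ (VecAll.all? P?) (tuples k xs))) ⟩
  ∑ xs (𝟙 ∘ P?) * ∑ (tuples k xs) (𝟙 ∘ VecAll.all? P?)
    ≡⟨ ∑-* xs _ _ ⟩
  ∑ xs (λ x → 𝟙 (P? x) * ∑ (tuples k xs) (𝟙 ∘ VecAll.all? P?))
    ≡⟨ ∑-cong (λ x → trans (*-∑ (𝟙 (P? x)) (tuples k xs) _) (∑-cong (𝟙-∷ x) (tuples k xs))) xs ⟩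
  ∑ xs (λ x → ∑ (tuples k xs) (λ T → 𝟙 (VecAll.all? P? (x ∷ T))))
    ≡⟨ ∑-cartesianProductWith _∷_ xs (tuples k xs) _ ⟨
  ∑ (tuples (suc k) xs) (𝟙 ∘ VecAll.all? P?)
    ≡⟨ count≡∑ (VecAll.all? P?) (tuples (suc k) xs) ⟨
  count (VecAll.all? P?) (tuples (suc k) xs) ∎
  where
  open ≡-Reasoning
  𝟙-∷ : ∀ x T → 𝟙 (P? x) * 𝟙 (VecAll.all? P? T) ≡ 𝟙 (VecAll.all? P? (x ∷ T))
  𝟙-∷ x T with does (P? x)
  ... | true  = *-identityˡ _
  ... | false = refl

unique? : ∀ {n k} → Decidable (VecUnique.Unique {A = Fin n} {n = k})
unique? = VecPairs.allPairs? (λ x y → ¬? (x ≟ y))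

length-allFin : ∀ n → length (allFin n) ≡ n
length-allFin n = length-tabulate {n = n} (λ i → i)

count-≟ : ∀ {n} (x : Fin n) → count (_≟ x) (allFin n) ≤ 1
count-≟ {n} x = count≤1 (_≟ x) (Unique.allFin⁺ n) λ p q → trans p (sym q)

count-members : ∀ {n k} (T : Vec (Fin n) k) → count (λ x → VecAny.any? (x ≟_) T) (allFin n) ≤ k
count-members {n} []      = ≤-reflexive (trans (count≡∑ _ (allFin n))
  (trans (∑-const (allFin n) 0) (*-zeroʳ (length (allFin n)))))
count-members {n} {suc k} (y ∷ T) = begin
  count (λ x → VecAny.any? (x ≟_) (y ∷ T)) (allFin n)
    ≡⟨ count≡∑ _ (allFin n) ⟩
  ∑ (allFin n) (λ x → 𝟙 (VecAny.any? (x ≟_) (y ∷ T)))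
    ≤⟨ ∑-mono (allFin n) (λ {x} _ →
         𝟙-⊎ (VecAny.any? (x ≟_) (y ∷ T)) (x ≟ y) (VecAny.any? (x ≟_) T) VecAny.toSum) ⟩
  ∑ (allFin n) (λ x → 𝟙 (x ≟ y) + 𝟙 (VecAny.any? (x ≟_) T))
    ≡⟨ ∑-+ (allFin n) _ _ ⟩
  ∑ (allFin n) (λ x → 𝟙 (x ≟ y)) + ∑ (allFin n) (λ x → 𝟙 (VecAny.any? (x ≟_) T))
    ≡⟨ cong₂ _+_ (count≡∑ (_≟ y) (allFin n)) (count≡∑ (λ x → VecAny.any? (x ≟_) T) (allFin n)) ⟨
  count (_≟ y) (allFin n) + count (λ x → VecAny.any? (x ≟_) T) (allFin n)
    ≤⟨ +-mono-≤ (count-≟ y) (count-members T) ⟩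
  suc k ∎
  where
  open ≤-Reasoning

repetitive : ∀ n k → ℕ
repetitive n k = count (¬? ∘ unique?) (tuples k (allFin n))

-- A tuple `x ∷ T` repeats an entry only if `x` is one of the at most `k` entries of `T` or `T`
-- already repeats one. The factor `n` on the left expresses a bound of order `n ^ (k - 1)` without
-- subtraction in the exponent.
repetitive-bound : ∀ n k → repetitive n k * n ≤ k * k * n ^ k
repetitive-bound n zero    = z≤n
repetitive-bound n (suc k) = begin
  repetitive n (suc k) * n
    ≡⟨ cong (_* n) (trans (count≡∑ _ (tuples (suc k) (allFin n))) (∑-cartesianProductWith _∷_ (allFin n) Ts _)) ⟩
  ∑ (allFin n) (λ x → ∑ Ts (λ T → 𝟙 (¬? (unique? (x ∷ T))))) * n
    ≤⟨ *-monoˡ-≤ n (∑-mono (allFin n) λ {x} _ → ∑-mono Ts λ {T} _ → 𝟙-∷ x T) ⟩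
  ∑ (allFin n) (λ x → ∑ Ts (λ T → 𝟙 (VecAny.any? (x ≟_) T) + 𝟙 (¬? (unique? T)))) * n
    ≡⟨ cong (_* n) (trans (∑-cong (λ x → ∑-+ Ts _ _) (allFin n)) (∑-+ (allFin n) _ _)) ⟩
  (∑ (allFin n) (λ x → ∑ Ts (λ T → 𝟙 (VecAny.any? (x ≟_) T))) +
   ∑ (allFin n) (λ x → ∑ Ts (𝟙 ∘ ¬? ∘ unique?))) * n
    ≡⟨ cong (_* n) (cong₂ _+_
         (trans (∑-swap (allFin n) Ts _)
           (∑-cong (λ T → sym (count≡∑ (λ x → VecAny.any? (x ≟_) T) (allFin n))) Ts))
         (trans (∑-const (allFin n) _) (cong₂ _*_ (length-allFin n) (sym (count≡∑ (¬? ∘ unique?) Ts))))) ⟩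
  (∑ Ts (λ T → count (λ x → VecAny.any? (x ≟_) T) (allFin n)) + n * repetitive n k) * n
    ≤⟨ *-monoˡ-≤ n (+-monoˡ-≤ (n * repetitive n k) (∑-mono Ts λ {T} _ → count-members T)) ⟩
  (∑ Ts (λ _ → k) + n * repetitive n k) * n
    ≡⟨ cong (λ s → (s + n * repetitive n k) * n)
         (trans (∑-const Ts k) (cong (_* k) (trans (length-tuples k (allFin n)) (cong (_^ k) (length-allFin n))))) ⟩
  (n ^ k * k + n * repetitive n k) * n
    ≡⟨ expand (n ^ k) k n (repetitive n k) ⟩
  n ^ k * k * n + n * (repetitive n k * n)
    ≤⟨ +-monoʳ-≤ (n ^ k * k * n) (*-monoʳ-≤ n (repetitive-bound n k)) ⟩
  n ^ k * k * n + n * (k * k * n ^ k)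
    -- The coefficient `k + k * k` is rounded up to `suc k * suc k`.
    ≤⟨ m≤m+n _ (suc k * (n * n ^ k)) ⟩
  n ^ k * k * n + n * (k * k * n ^ k) + suc k * (n * n ^ k)
    ≡⟨ collect (n ^ k) k n ⟩
  suc k * suc k * n ^ suc k ∎
  where
  open ≤-Reasoning
  Ts = tuples k (allFin n)
  expand : ∀ p k n r → (p * k + n * r) * n ≡ p * k * n + n * (r * n)
  expand = solve-∀
  collect : ∀ p k n → p * k * n + n * (k * k * p) + suc k * (n * p) ≡ suc k * suc k * (n * p)
  collect = solve-∀
  𝟙-∷ : ∀ x (T : Vec (Fin n) k) → 𝟙 (¬? (unique? (x ∷ T))) ≤ 𝟙 (VecAny.any? (x ≟_) T) + 𝟙 (¬? (unique? T))
  𝟙-∷ x T = 𝟙-⊎ (¬? (unique? (x ∷ T))) (VecAny.any? (x ≟_) T) (¬? (unique? T)) split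
    where
    split : ¬ VecUnique.Unique (x ∷ T) → VecAny.Any (x ≡_) T ⊎ ¬ VecUnique.Unique T
    split ¬xT! = [ (λ x∉T → inj₂ λ T! → ¬xT! (x∉T VecPairs.∷ T!)) , inj₁ ]′
                   (VecAll.decide (λ y → swap (toSum (x ≟ y))) T)

-- By `power-mean` and `count-^` it suffices to count pairs of a member `e` of `E` and a tuple `T`
-- of vertices related to it. A tuple with distinct entries lies in at most `c` pairs, and a
-- repetitive one in at most `length E`. The extra factor `n` comes from `repetitive-bound`.
kővári-sós-turán : ∀ {A : Set} {n} {R : A → Fin n → Set} (R? : ∀ e x → Dec (R e x)) E k c →
  (∀ (T : Vec (Fin n) (suc k)) → VecUnique.Unique T → count (λ e → VecAll.all? (R? e) T) E ≤ c) →
  ∑ E (λ e → count (R? e) (allFin n)) ^ suc k * n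
    ≤ length E ^ k * ((c * n + suc k * suc k * length E) * n ^ suc k)
kővári-sós-turán {n = n} R? E k c few = begin
  ∑ E (λ e → count (R? e) (allFin n)) ^ suc k * n
    ≤⟨ *-monoˡ-≤ n (power-mean E _ k) ⟩
  N ^ k * ∑ E (λ e → count (R? e) (allFin n) ^ suc k) * n
    ≡⟨ cong (λ s → N ^ k * s * n) (trans (∑-cong (λ e → count-^ (R? e) (suc k) (allFin n)) E)
         (∑-count (λ e → VecAll.all? (R? e)) E Ts)) ⟩
  N ^ k * ∑ Ts (λ T → count (λ e → VecAll.all? (R? e) T) E) * n
    ≤⟨ *-monoˡ-≤ n (*-monoʳ-≤ (N ^ k) (∑-mono Ts λ {T} _ → common T)) ⟩
  N ^ k * ∑ Ts (λ T → c + 𝟙 (¬? (unique? T)) * N) * n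
    ≡⟨ cong (λ s → N ^ k * s * n) (trans (∑-+ Ts _ _) (cong₂ _+_
         (trans (∑-const Ts c) (cong (_* c)
           (trans (length-tuples (suc k) (allFin n)) (cong (_^ suc k) (length-allFin n)))))
         (trans (sym (∑-* Ts _ N)) (cong (_* N) (sym (count≡∑ (¬? ∘ unique?) Ts)))))) ⟩
  N ^ k * (n ^ suc k * c + repetitive n (suc k) * N) * n
    ≡⟨ expand (N ^ k) (n ^ suc k) c (repetitive n (suc k)) N n ⟩
  N ^ k * (n ^ suc k * c * n + N * (repetitive n (suc k) * n))
    ≤⟨ *-monoʳ-≤ (N ^ k) (+-monoʳ-≤ (n ^ suc k * c * n) (*-monoʳ-≤ N (repetitive-bound n (suc k)))) ⟩
  N ^ k * (n ^ suc k * c * n + N * (suc k * suc k * n ^ suc k))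
    ≡⟨ cong (N ^ k *_) (collect (n ^ suc k) c n N (suc k * suc k)) ⟩
  N ^ k * ((c * n + suc k * suc k * N) * n ^ suc k) ∎
  where
  open ≤-Reasoning
  N = length E
  Ts = tuples (suc k) (allFin n)
  expand : ∀ a p c r N n → a * (p * c + r * N) * n ≡ a * (p * c * n + N * (r * n))
  expand = solve-∀
  collect : ∀ p c n N q → p * c * n + N * (q * p) ≡ (c * n + q * N) * p
  collect = solve-∀
  common : ∀ T → count (λ e → VecAll.all? (R? e) T) E ≤ c + 𝟙 (¬? (unique? T)) * N
  common T with unique? T
  ... | yes T! = m≤n⇒m≤n+o _ (few T T!)
  ... | no _   = ≤-trans (length-filter _ E) (≤-trans (≤-reflexive (sym (*-identityˡ N))) (m≤n+m _ c))

-- Sizes of uniform families and of families with a transversal.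

x∉p-x : ∀ {n} (p : Subset n) x → x ∉ˢ p - x
x∉p-x (_ ∷ p) zero    ()
x∉p-x (_ ∷ p) (suc x) (there x∈) = x∉p-x p x x∈

p-x∪x≡p : ∀ {n} {p : Subset n} {x} → x ∈ˢ p → (p - x) ∪ ⁅ x ⁆ ≡ p
p-x∪x≡p {p = _ ∷ p}       here       = cong (inside ∷_) (trans (∪-identityʳ _) (p─⊥≡p p))
p-x∪x≡p {p = inside ∷ p}  (there x∈) = cong (inside ∷_) (p-x∪x≡p x∈)
p-x∪x≡p {p = outside ∷ p} (there x∈) = cong (outside ∷_) (p-x∪x≡p x∈)

∣p-x∣ : ∀ {n} {p : Subset n} {x} → x ∈ˢ p → suc ∣ p - x ∣ ≡ ∣ p ∣
∣p-x∣ {p = _ ∷ p}       here       = cong (suc ∘ ∣_∣) (p─⊥≡p p)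
∣p-x∣ {p = inside ∷ p}  (there x∈) = cong suc (∣p-x∣ x∈)
∣p-x∣ {p = outside ∷ p} (there x∈) = ∣p-x∣ x∈

∣p∣≡0⇒Empty : ∀ {n} {p : Subset n} → ∣ p ∣ ≡ 0 → Empty p
∣p∣≡0⇒Empty ∣p∣≡0 (_ , x∈p) with trans (∣p-x∣ x∈p) ∣p∣≡0
... | ()

∣p∣≡suc⇒Nonempty : ∀ {n k} {p : Subset n} → ∣ p ∣ ≡ suc k → Nonempty p
∣p∣≡suc⇒Nonempty {n} {p = p} ∣p∣≡suc with nonempty? p
... | yes p≢∅ = p≢∅
... | no  p≡∅ with trans (sym ∣p∣≡suc) (trans (cong ∣_∣ (Empty-unique p≡∅)) (∣⊥∣≡0 n))
...   | ()

-- Here the implication is needed only between members of the list. Deleting `x`, for instance, is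
-- injective only on the sets that contain `x`.
AllPairs-map-∈ : ∀ {A : Set} {R S : A → A → Set} {xs} →
  (∀ {x y} → x ∈ xs → y ∈ xs → R x y → S x y) → AllPairs R xs → AllPairs S xs
AllPairs-map-∈ R⇒S []         = []
AllPairs-map-∈ R⇒S (rx ∷ rxs) =
  All.tabulate (λ y∈ → R⇒S (here refl) (there y∈) (All.lookup rx y∈)) ∷
  AllPairs-map-∈ (λ x∈ y∈ → R⇒S (there x∈) (there y∈)) rxs

mutual
  -- Only the empty set has size 0, and nonempty sets are all met by the transversal `allFin n`. The
  -- bound is a crude form of the binomial coefficient.
  uniform-length : ∀ k {n} {F : List (Subset n)} → Unique F → All (λ e → ∣ e ∣ ≡ k) F → length F ≤ n ^ k
  uniform-length zero    []                 _  = z≤n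
  uniform-length zero    (_ ∷ [])           _  = ≤-refl
  uniform-length zero    ((e≢e′ ∷ _) ∷ _)   (∣e∣≡0 ∷ ∣e′∣≡0 ∷ _) =
    contradiction (trans (empty ∣e∣≡0) (sym (empty ∣e′∣≡0))) e≢e′
    where empty = λ {p} (eq : ∣ p ∣ ≡ 0) → Empty-unique (∣p∣≡0⇒Empty {p = p} eq)
  uniform-length (suc k) {n} {F} F! ∣F∣ = subst (λ m → length F ≤ m * n ^ k) (length-allFin n)
    (transversal-length k (allFin n) F! ∣F∣ λ e∈ →
      let x , x∈e = ∣p∣≡suc⇒Nonempty (All.lookup ∣F∣ e∈) in x , ∈-allFin x , x∈e)

  -- Sort the members by a vertex `x` of `xs` that they contain. Deleting `x` maps those containing
  -- it injectively to sets of size `k`.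
  transversal-length : ∀ k {n} {F : List (Subset n)} xs → Unique F → All (λ e → ∣ e ∣ ≡ suc k) F →
    (∀ {e} → e ∈ F → ∃[ x ] x ∈ xs × x ∈ˢ e) → length F ≤ length xs * n ^ k
  transversal-length k {n} {F} xs F! ∣F∣ meets = begin
    length F                                      ≤⟨ length≤∑count (λ e x → x ∈ˢ? e) F xs meets ⟩
    ∑ xs (λ x → count (x ∈ˢ?_) F)                 ≤⟨ ∑-mono xs (λ {x} _ → link-length x) ⟩
    ∑ xs (λ _ → n ^ k)                            ≡⟨ ∑-const xs (n ^ k) ⟩
    length xs * n ^ k                             ∎
    where
    open ≤-Reasoning
    link-length : ∀ x → count (x ∈ˢ?_) F ≤ n ^ k
    link-length x = subst (_≤ n ^ k) (length-map (_- x) Fₓ) (uniform-length k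
      (AllPairs.map⁺ (AllPairs-map-∈
        (λ e∈ e′∈ e≢e′ e-x≡e′-x → e≢e′ (trans (sym (p-x∪x≡p (proj₂ (∈Fₓ e∈))))
          (trans (cong (_∪ ⁅ x ⁆) e-x≡e′-x) (p-x∪x≡p (proj₂ (∈Fₓ e′∈))))))
        (Unique.filter⁺ (x ∈ˢ?_) F!)))
      (All.map⁺ (All.tabulate λ e∈ →
        ℕ.suc-injective (trans (∣p-x∣ (proj₂ (∈Fₓ e∈))) (All.lookup ∣F∣ (proj₁ (∈Fₓ e∈)))))))
      where
      Fₓ = filter (x ∈ˢ?_) F
      ∈Fₓ : ∀ {e} → e ∈ Fₓ → e ∈ F × x ∈ˢ e
      ∈Fₓ = ∈-filter⁻ (x ∈ˢ?_) {xs = F}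

-- Listings of vertices, partial injections and greedy matching.

elements : ∀ {n} → Subset n → List (Fin n)
elements []            = []
elements (inside  ∷ p) = zero ∷ map suc (elements p)
elements (outside ∷ p) = map suc (elements p)

∈-elements⁺ : ∀ {n} {p : Subset n} {x} → x ∈ˢ p → x ∈ elements p
∈-elements⁺ {p = inside ∷ _}  here       = here refl
∈-elements⁺ {p = inside ∷ _}  (there x∈) = there (∈-map⁺ suc (∈-elements⁺ x∈))
∈-elements⁺ {p = outside ∷ _} (there x∈) = ∈-map⁺ suc (∈-elements⁺ x∈)

∈-elements⁻ : ∀ {n} (p : Subset n) {x} → x ∈ elements p → x ∈ˢ p
∈-elements⁻ (inside  ∷ p) (here refl) = here
∈-elements⁻ (inside  ∷ p) (there x∈) with _ , y∈ , refl ← ∈-map⁻ suc x∈ = there (∈-elements⁻ p y∈)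
∈-elements⁻ (outside ∷ p) x∈         with _ , y∈ , refl ← ∈-map⁻ suc x∈ = there (∈-elements⁻ p y∈)

length-elements : ∀ {n} (p : Subset n) → length (elements p) ≡ ∣ p ∣
length-elements []            = refl
length-elements (inside  ∷ p) = cong suc (trans (length-map suc (elements p)) (length-elements p))
length-elements (outside ∷ p) = trans (length-map suc (elements p)) (length-elements p)

elements-unique : ∀ {n} (p : Subset n) → Unique (elements p)
elements-unique []            = []
elements-unique (inside  ∷ p) =
  All.map⁺ (All.universal (λ _ ()) (elements p)) ∷ Unique.map⁺ suc-injective (elements-unique p)
elements-unique (outside ∷ p) = Unique.map⁺ suc-injective (elements-unique p)

∈-zip⁻ : ∀ {A B : Set} (xs : List A) (ys : List B) {a b} → (a , b) ∈ zip xs ys → a ∈ xs × b ∈ ys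
∈-zip⁻ (x ∷ xs) (y ∷ ys) (here refl) = here refl , here refl
∈-zip⁻ (x ∷ xs) (y ∷ ys) (there p)   = let a∈ , b∈ = ∈-zip⁻ xs ys p in there a∈ , there b∈

length-zip : ∀ {A B : Set} (xs : List A) (ys : List B) → length xs ≡ length ys → length (zip xs ys) ≡ length xs
length-zip []       []       _  = refl
length-zip (x ∷ xs) (y ∷ ys) eq = cong suc (length-zip xs ys (cong (_∸ 1) eq))

map≡-zip : ∀ {A B : Set} (f : A → B) xs ys → length xs ≡ length ys →
  (∀ {a b} → (a , b) ∈ zip xs ys → f a ≡ b) → map f xs ≡ ys
map≡-zip f []       []       _  _  = refl
map≡-zip f (x ∷ xs) (y ∷ ys) eq f≡ =
  cong₂ _∷_ (f≡ (here refl)) (map≡-zip f xs ys (cong (_∸ 1) eq) (f≡ ∘ there))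

Apart : ∀ {A B : Set} → A × B → A × B → Set
Apart (a , b) (a′ , b′) = a ≢ a′ × b ≢ b′

-- A partial injection is represented by the list of its argument-value pairs.
PartialInjection : ∀ {A B : Set} → List (A × B) → Set
PartialInjection = AllPairs Apart

zip-partialInjection : ∀ {A B : Set} {xs : List A} {ys : List B} →
  Unique xs → Unique ys → PartialInjection (zip xs ys)
zip-partialInjection []           _            = []
zip-partialInjection (_ ∷ _)      []           = []
zip-partialInjection {xs = _ ∷ xs} {_ ∷ ys} (x∉ ∷ xs!) (y∉ ∷ ys!) =
  All.tabulate (λ p∈ → let a∈ , b∈ = ∈-zip⁻ xs ys p∈ in All.lookup x∉ a∈ , All.lookup y∉ b∈) ∷
  zip-partialInjection xs! ys!

transpose-matchˡ : ∀ {n} (i j : Fin n) → transpose i j i ≡ j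
transpose-matchˡ i j rewrite dec-true (i ≟ i) refl = refl

transpose-mismatch : ∀ {n} (i j : Fin n) {k} → k ≢ i → k ≢ j → transpose i j k ≡ k
transpose-mismatch i j {k} k≢i k≢j rewrite dec-false (k ≟ i) k≢i | dec-false (k ≟ j) k≢j = refl

transpose-injective : ∀ {n} (i j : Fin n) → Injective _≡_ _≡_ (transpose i j)
transpose-injective i j eq =
  trans (sym (transpose-inverse j i)) (trans (cong (transpose j i) eq) (transpose-inverse j i))

-- Given `f` for the remaining pairs, composing it with the transposition of `f a` and `b` repairs
-- the value at `a`. The other prescribed values are untouched: they differ from `f a` by
-- injectivity of `f` and from `b` by `Apart`.
extend : ∀ {m n} → m ≤ n → (ps : List (Fin m × Fin n)) → PartialInjection ps →
  ∃[ f ] Injective _≡_ _≡_ f × (∀ {a b} → (a , b) ∈ ps → f a ≡ b)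
extend m≤n []             _              = (λ i → inject≤ i m≤n) , inject≤-injective m≤n m≤n _ _ , λ ()
extend m≤n ((a , b) ∷ ps) (ab# ∷ ps#) with f , f-inj , f≡ ← extend m≤n ps ps# =
  transpose (f a) b ∘ f , f-inj ∘ transpose-injective (f a) b , λ where
    (here refl) → transpose-matchˡ (f a) b
    (there p)   → let a≢a′ , b≢b′ = All.lookup ab# p in trans
      (transpose-mismatch (f a) b (a≢a′ ∘ sym ∘ f-inj) λ fa′≡b → b≢b′ (trans (sym fa′≡b) (f≡ p)))
      (f≡ p)

-- Edges are given as lists of their vertices.  Each in turn is sent to a member of F that
-- avoids all values used so far.
greedy-matching : ∀ {A : Set} {n k m} {F : List (Subset n)} → All (λ g → ∣ g ∣ ≡ k) F →
  (∀ xs → length xs ≤ m → ∃[ g ] g ∈ F × All (_∉ˢ g) xs) →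
  ∀ (es : List (List A)) ps → PartialInjection ps →
  All Unique es → AllPairs Disjoint es → All (λ e → length e ≡ k) es →
  (∀ {e a b} → e ∈ es → (a , b) ∈ ps → a ∉ e) → length ps + length es * k ≤ m →
  ∃[ qs ] PartialInjection qs × ps ⊆ qs × All (λ e → ∃[ g ] g ∈ F × zip e (elements g) ⊆ qs) es
greedy-matching ∣F∣ avoid []       ps ps# _ _ _ _ _ = ps , ps# , (λ p → p) , []
greedy-matching {k = k} {m} {F} ∣F∣ avoid (e ∷ es) ps ps# (e! ∷ es!) (e∩ ∷ es∩) (∣e∣ ∷ ∣es∣) fresh bound =
  let g , g∈F , ps∉g = avoid (map proj₂ ps)
        (≤-trans (≤-reflexive (length-map proj₂ ps)) (m+n≤o⇒m≤o (length ps) bound))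
      ps′# = AllPairs.++⁺ (zip-partialInjection e! (elements-unique g)) ps#
        (All.tabulate λ p∈ → All.tabulate λ q∈ → apart g ps∉g p∈ q∈)
      qs , qs# , ⊆qs , matched = greedy-matching ∣F∣ avoid es (zip e (elements g) ++ ps) ps′#
        es! es∩ ∣es∣ (fresh′ g) (bound′ g g∈F)
  in qs , qs# , ⊆qs ∘ ∈-++⁺ʳ (zip e (elements g)) , (g , g∈F , ⊆qs ∘ ∈-++⁺ˡ) ∷ matched
  where
  apart : ∀ g → All (_∉ˢ g) (map proj₂ ps) → ∀ {p q} → p ∈ zip e (elements g) → q ∈ ps → Apart p q
  apart g ps∉g p∈ q∈ =
    let a∈e , b∈g = ∈-zip⁻ e (elements g) p∈ in
    (λ { refl → fresh (here refl) q∈ a∈e }) ,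
    (λ { refl → All.lookup ps∉g (∈-map⁺ proj₂ q∈) (∈-elements⁻ g b∈g) })

  -- Disjointness of the edges enters here: no vertex of `e` lies in a later edge, so every later
  -- edge is still wholly unassigned.
  fresh′ : ∀ g {e′ a b} → e′ ∈ es → (a , b) ∈ zip e (elements g) ++ ps → a ∉ e′
  fresh′ g e′∈ p∈ a∈e′ with ∈-++⁻ (zip e (elements g)) p∈
  ... | inj₁ p∈zip = All.lookup e∩ e′∈ (proj₁ (∈-zip⁻ e (elements g) p∈zip) , a∈e′)
  ... | inj₂ p∈ps  = fresh (there e′∈) p∈ps a∈e′

  -- Matching `e` adds `k` pairs and removes one edge from the list, so the total compared with `m`
  -- does not change.
  bound′ : ∀ g → g ∈ F → length (zip e (elements g) ++ ps) + length es * k ≤ m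
  bound′ g g∈F = ≤-trans (≤-reflexive (trans
    (cong (_+ length es * k) (trans (length-++ (zip e (elements g)))
      (cong (_+ length ps) (trans (length-zip e (elements g)
        (trans ∣e∣ (sym (trans (length-elements g) (All.lookup ∣F∣ g∈F))))) ∣e∣))))
    (reorder k (length ps) _))) bound
    where
    reorder : ∀ a b c → a + b + c ≡ b + (a + c)
    reorder = solve-∀

-- Images of edges and the embedding of `K H t`.

∈-image⁺ : ∀ {m n} (f : Fin m → Fin n) {e i} → i ∈ˢ e → f i ∈ˢ image f e
∈-image⁺ f {e} {i} i∈e = lookup⇒[]= (f i) (image f e)
  (trans (lookup∘tabulate _ (f i)) (dec-true (preimage? f e (f i)) (i , i∈e , refl)))

∈-image⁻ : ∀ {m n} (f : Fin m → Fin n) e {j} → j ∈ˢ image f e → ∃[ i ] i ∈ˢ e × f i ≡ j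
∈-image⁻ f e {j} j∈
  with preimage? f e j
     | trans (sym (lookup∘tabulate (λ j → does (preimage? f e j)) j)) ([]=⇒lookup j∈)
... | yes found | _ = found
... | no _      | ()

module _ {m k} (p : Subset m) (q : Subset k) where
  ∈-++ˢˡ : ∀ {i} → i ∈ˢ p → i ↑ˡ k ∈ˢ p Vec.++ q
  ∈-++ˢˡ {i} i∈ = lookup⇒[]= (i ↑ˡ k) (p Vec.++ q) (trans (lookup-++ˡ p q i) ([]=⇒lookup i∈))

  ∈-++ˢʳ : ∀ {i} → i ∈ˢ q → m ↑ʳ i ∈ˢ p Vec.++ q
  ∈-++ˢʳ {i} i∈ = lookup⇒[]= (m ↑ʳ i) (p Vec.++ q) (trans (lookup-++ʳ p q i) ([]=⇒lookup i∈))

  ∈-++ˢ⁻ : ∀ {j} → j ∈ˢ p Vec.++ q → (∃[ i ] i ∈ˢ p × i ↑ˡ k ≡ j) ⊎ (∃[ i ] i ∈ˢ q × m ↑ʳ i ≡ j)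
  ∈-++ˢ⁻ {j} j∈ with splitAt m j in eq
  ... | inj₁ i with refl ← splitAt⁻¹-↑ˡ {m} {k} {j} eq =
        inj₁ (i , lookup⇒[]= i p (trans (sym (lookup-++ˡ p q i)) ([]=⇒lookup j∈)) , refl)
  ... | inj₂ i with refl ← splitAt⁻¹-↑ʳ {m} {k} {j} eq =
        inj₂ (i , lookup⇒[]= i q (trans (sym (lookup-++ʳ p q i)) ([]=⇒lookup j∈)) , refl)

-- The old vertices of the edge go onto `g`, and its only other vertex is the new vertex `i`. The
-- hypothesis compares listings because `greedy-matching` prescribes `f` through zipped listings.
image-++⁅⁆ : ∀ {v t n} (f : Fin (v + t) → Fin n) e i g →
  map f (map (_↑ˡ t) (elements e)) ≡ elements g → image f (e Vec.++ ⁅ i ⁆) ≡ g ∪ ⁅ f (v ↑ʳ i) ⁆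
image-++⁅⁆ {v} {t} f e i g f[e]≡g = ⊆-antisym to from
  where
  to : ∀ {x} → x ∈ˢ image f (e Vec.++ ⁅ i ⁆) → x ∈ˢ g ∪ ⁅ f (v ↑ʳ i) ⁆
  to x∈ with ∈-image⁻ f (e Vec.++ ⁅ i ⁆) x∈
  ... | j , j∈ , refl with ∈-++ˢ⁻ e ⁅ i ⁆ j∈
  ...   | inj₁ (a , a∈e , refl) = x∈p∪q⁺ (inj₁ (∈-elements⁻ g
            (subst (f (a ↑ˡ t) ∈_) f[e]≡g (∈-map⁺ f (∈-map⁺ (_↑ˡ t) (∈-elements⁺ a∈e))))))
  ...   | inj₂ (b , b∈i , refl) with refl ← x∈⁅y⁆⇒x≡y i b∈i = x∈p∪q⁺ (inj₂ (x∈⁅x⁆ _))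

  from : ∀ {x} → x ∈ˢ g ∪ ⁅ f (v ↑ʳ i) ⁆ → x ∈ˢ image f (e Vec.++ ⁅ i ⁆)
  from x∈ with x∈p∪q⁻ g _ x∈
  ... | inj₂ x∈⁅⁆ with refl ← x∈⁅y⁆⇒x≡y _ x∈⁅⁆ = ∈-image⁺ f (∈-++ˢʳ e ⁅ i ⁆ (x∈⁅x⁆ i))
  ... | inj₁ x∈g with ∈-map⁻ f (subst (_ ∈_) (sym f[e]≡g) (∈-elements⁺ x∈g))
  ...   | _ , a∈ , refl with ∈-map⁻ (_↑ˡ t) a∈
  ...     | a , a∈e , refl = ∈-image⁺ f (∈-++ˢˡ e ⁅ i ⁆ (∈-elements⁻ e a∈e))

-- If every member of `F` met `xs`, then `transversal-length` would contradict the size of `F`.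
avoiding-member : ∀ {n k m} {F : List (Subset n)} → Unique F → All (λ g → ∣ g ∣ ≡ suc k) F →
  m * n ^ k < length F → ∀ xs → length xs ≤ m → ∃[ g ] g ∈ F × All (_∉ˢ g) xs
avoiding-member {n} {k} {F = F} F! ∣F∣ large xs ∣xs∣≤m
  with Any.any? (λ g → All.all? (λ x → ¬? (x ∈ˢ? g)) xs) F
... | yes avoided = find avoided
... | no  ¬avoided = contradiction
      (≤-trans (transversal-length k xs F! ∣F∣ meets) (*-monoˡ-≤ (n ^ k) ∣xs∣≤m)) (<⇒≱ large)
  where
  meets : ∀ {g} → g ∈ F → ∃[ x ] x ∈ xs × x ∈ˢ g
  meets {g} g∈F with All.search (_∈ˢ? g) xs
  ... | inj₁ ∉g = contradiction (lose g∈F ∉g) ¬avoided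
  ... | inj₂ ∈g = find ∈g

module _ {d v t n} (H : Hypergraph d v) (disjoint : PairwiseDisjoint H) (G : Hypergraph (suc d) n)
         (v+t≤n : v + t ≤ n) {F : List (Subset n)} (∣F∣ : All (λ g → ∣ g ∣ ≡ d) F)
         {T : Vec (Fin n) t} (T! : VecUnique.Unique T)
         (joined : ∀ {g} → g ∈ F → ∀ i → Vec.lookup T i ∉ˢ g × g ∪ ⁅ Vec.lookup T i ⁆ ∈ edges G)
         (avoid : ∀ xs → length xs ≤ t + size H * d → ∃[ g ] g ∈ F × All (_∉ˢ g) xs) where

  private
    lifted : Subset v → List (Fin (v + t))
    lifted e = map (_↑ˡ t) (elements e)

    -- The greedy matching starts from these pairs, so that its choices also avoid the entries of
    -- `T`.
    new : List (Fin (v + t) × Fin n)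
    new = map (λ i → v ↑ʳ i , Vec.lookup T i) (allFin t)

    lifted-disjoint : AllPairs Disjoint (map lifted (edges H))
    lifted-disjoint = AllPairs.map⁺ (AllPairs-map-∈
      (λ {e} {e′} e∈ e′∈ e≢e′ (a∈ , a∈′) → meet e∈ e′∈ e≢e′ a∈ a∈′) (unique H))
      where
      meet : ∀ {e e′ a} → e ∈ edges H → e′ ∈ edges H → e ≢ e′ → a ∈ lifted e → ¬ a ∈ lifted e′
      meet {e} {e′} e∈ e′∈ e≢e′ a∈ a∈′ with ∈-map⁻ (_↑ˡ t) a∈ | ∈-map⁻ (_↑ˡ t) a∈′
      ... | x , x∈e , refl | y , y∈e′ , x≡y with refl ← ↑ˡ-injective t x y x≡y =
        disjoint e∈ e′∈ e≢e′ (x , x∈p∩q⁺ (∈-elements⁻ e x∈e , ∈-elements⁻ e′ y∈e′))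

    ∣lifted∣ : ∀ {e} → e ∈ edges H → length (lifted e) ≡ d
    ∣lifted∣ {e} e∈ = trans (length-map (_↑ˡ t) (elements e))
                            (trans (length-elements e) (All.lookup (uniform H) e∈))

    fresh : ∀ {e a b} → e ∈ map lifted (edges H) → (a , b) ∈ new → a ∉ e
    fresh e∈ p∈ a∈ with ∈-map⁻ lifted e∈ | ∈-map⁻ _ p∈
    ... | _ , _ , refl | i , _ , refl with ∈-map⁻ (_↑ˡ t) a∈
    ...   | x , _ , eq with trans (sym (splitAt-↑ʳ v t i)) (trans (cong (splitAt v) eq) (splitAt-↑ˡ v x t))
    ...     | ()

    new# : PartialInjection new
    new# = AllPairs.map⁺ (AllPairs.map
      (λ i≢j → i≢j ∘ ↑ʳ-injective v _ _ , i≢j ∘ lookup-injective T! _ _) (Unique.allFin⁺ t))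

    sizes : length new + length (map lifted (edges H)) * d ≤ t + size H * d
    sizes = ≤-reflexive (cong₂ (λ a b → a + b * d)
      (trans (length-map _ (allFin t)) (length-allFin t)) (length-map lifted (edges H)))

  -- Starting from `new`, the edges of `H` are matched greedily into `F`; the `t` new vertices and
  -- `d` vertices per edge never exceed the bound in `avoid`. Then `extend` assigns the vertices
  -- outside all edges, for which `v + t ≤ n` leaves room, and `joined` puts the images of the edges
  -- in `G`.
  K-embeds : ∃[ f ] IsEmbedding (K H t) G f
  K-embeds =
    let qs , qs# , new⊆qs , matched = greedy-matching ∣F∣ avoid (map lifted (edges H)) new new#
          (All.map⁺ (All.universal
            (λ e → Unique.map⁺ (↑ˡ-injective t _ _) (elements-unique e)) (edges H)))
          lifted-disjoint (All.map⁺ (All.tabulate ∣lifted∣)) fresh sizes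
        f , f-inj , f≡ = extend v+t≤n qs qs#
    in f , f-inj , All.tabulate (λ e∈ → preserves f f≡ new⊆qs (All.map⁻ matched) e∈)
    where
    preserves : ∀ {qs} f → (∀ {a b} → (a , b) ∈ qs → f a ≡ b) → new ⊆ qs →
      All (λ e → ∃[ g ] g ∈ F × zip (lifted e) (elements g) ⊆ qs) (edges H) →
      ∀ {e} → e ∈ edges (K H t) → image f e ∈ edges G
    preserves f f≡ new⊆qs matched e∈K
      with e , i , e∈ , _ , refl ← ∈-cartesianProductWith⁻ _ (edges H) (allFin t) e∈K
      with g , g∈F , zip⊆qs ← All.lookup matched e∈
      = subst (_∈ edges G) (sym (trans
          (image-++⁅⁆ f e i g (map≡-zip f (lifted e) (elements g)
            (trans (∣lifted∣ e∈) (sym (trans (length-elements g) (All.lookup ∣F∣ g∈F)))) (f≡ ∘ zip⊆qs)))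
          (cong (λ x → g ∪ ⁅ x ⁆) (f≡ (new⊆qs (∈-map⁺ _ (∈-allFin i)))))))
        (proj₂ (joined g∈F i))

-- The shadow, its degrees and the final estimate.

module _ {d n} (G : Hypergraph (suc d) n) where
  private
    _≟ˢ_ = ≡-dec {n = n} _≟ᵇ_
    open DecMembership _≟ˢ_ using () renaming (_∈?_ to _∈ᴱ?_)

  Joined : Subset n → Fin n → Set
  Joined e x = x ∉ˢ e × e ∪ ⁅ x ⁆ ∈ edges G

  joined? : ∀ e x → Dec (Joined e x)
  joined? e x = ¬? (x ∈ˢ? e) ×-dec (e ∪ ⁅ x ⁆ ∈ᴱ? edges G)

  private
    -- Deleting a vertex outside an edge leaves the edge unchanged; the filter on size discards
    -- these sets.
    candidates : List (Subset n)
    candidates = filter (λ e → ∣ e ∣ ℕ.≟ d) (cartesianProductWith _-_ (edges G) (allFin n))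

  shadow : List (Subset n)
  shadow = deduplicate _≟ˢ_ candidates

  shadow-unique : Unique shadow
  shadow-unique = deduplicate-! _≟ˢ_ candidates

  shadow-uniform : All (λ e → ∣ e ∣ ≡ d) shadow
  shadow-uniform = All.deduplicate⁺ _≟ˢ_ (All.all-filter _ (cartesianProductWith _-_ (edges G) (allFin n)))

  -- Every edge `f` has a vertex `x` and arises from the pair `f - x , x`, while a pair `e , x`
  -- determines the edge `e ∪ ⁅ x ⁆`.
  size≤∑degrees : size G ≤ ∑ shadow (λ e → count (joined? e) (allFin n))
  size≤∑degrees = begin
    size G
      ≤⟨ length≤∑count Extends? (edges G) (cartesianProduct shadow (allFin n)) covered ⟩
    ∑ (cartesianProduct shadow (allFin n)) (λ p → count (λ f → Extends? f p) (edges G))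
      ≤⟨ ∑-mono (cartesianProduct shadow (allFin n)) (λ { {e , x} _ →
           count≤𝟙 (λ f → Extends? f (e , x)) (joined? e x) (unique G)
           (λ (_ , f≡) (_ , f′≡) → trans f≡ (sym f′≡)) (λ { f∈ (x∉e , refl) → x∉e , f∈ }) }) ⟩
    ∑ (cartesianProduct shadow (allFin n)) (λ (e , x) → 𝟙 (joined? e x))
      ≡⟨ ∑-cartesianProductWith _,_ shadow (allFin n) _ ⟩
    ∑ shadow (λ e → ∑ (allFin n) (λ x → 𝟙 (joined? e x)))
      ≡⟨ ∑-cong (λ e → count≡∑ (joined? e) (allFin n)) shadow ⟨
    ∑ shadow (λ e → count (joined? e) (allFin n)) ∎
    where
    open ≤-Reasoning
    Extends : Subset n → Subset n × Fin n → Set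
    Extends f (e , x) = x ∉ˢ e × f ≡ e ∪ ⁅ x ⁆

    Extends? : ∀ f p → Dec (Extends f p)
    Extends? f (e , x) = ¬? (x ∈ˢ? e) ×-dec (f ≟ˢ (e ∪ ⁅ x ⁆))

    covered : ∀ {f} → f ∈ edges G → ∃[ p ] p ∈ cartesianProduct shadow (allFin n) × Extends f p
    covered {f} f∈ =
      let ∣f∣ = All.lookup (uniform G) f∈
          x , x∈f = ∣p∣≡suc⇒Nonempty ∣f∣
      in (f - x , x) ,
         ∈-cartesianProduct⁺ (∈-deduplicate⁺ _≟ˢ_ (∈-filter⁺ _ (∈-cartesianProductWith⁺ _-_ f∈ (∈-allFin x))
           (ℕ.suc-injective (trans (∣p-x∣ x∈f) ∣f∣)))) (∈-allFin x) ,
         x∉p-x f x , sym (p-x∪x≡p x∈f)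

-- With more common links than this, some link would avoid any `t + size H * suc d` given vertices,
-- by `avoiding-member`. Then `K-embeds` would find `K H t` in `G`.
few-common-links : ∀ {d v t n} (H : Hypergraph (suc d) v) → PairwiseDisjoint H → v + t ≤ n →
  (G : Hypergraph (suc (suc d)) n) → Free (K H t) G → (T : Vec (Fin n) t) → VecUnique.Unique T →
  count (λ e → VecAll.all? (joined? G e) T) (shadow G) ≤ (t + size H * suc d) * n ^ d
few-common-links {d} H disjoint v+t≤n G free T T! = ≮⇒≥ λ large → free
  (K-embeds H disjoint G v+t≤n ∣F∣ T!
    (λ g∈ i → VecAll.lookup (proj₂ (∈-filter⁻ common? {xs = shadow G} g∈)) (∈-lookup i T))
    (avoiding-member (Unique.filter⁺ common? (shadow-unique G)) ∣F∣ large))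
  where
  common? = λ e → VecAll.all? (joined? G e) T
  ∣F∣ = All.filter⁺ common? (shadow-uniform G)

-- Since `_=O[n^_/_]` raises its constant to a positive power, a constant bounding the power of
-- `g n` can itself serve as that constant.
m≤m^suc : ∀ m k → m ≤ m ^ suc k
m≤m^suc zero    k = z≤n
m≤m^suc (suc m) k = ≤-trans (≤-reflexive (sym (^-identityʳ (suc m)))) (^-monoʳ-≤ (suc m) (s≤s (z≤n {k})))

free-size : ∀ {d v k n} (H : Hypergraph (suc d) v) → PairwiseDisjoint H → v + suc k ≤ n →
  (G : Hypergraph (suc (suc d)) n) → Free (K H (suc k)) G →
  size G ^ suc k ≤ (suc k + size H * suc d + suc k * suc k) * n ^ (k + suc d * suc k)
free-size {d} {v} {k} {n} H disjoint v+t≤n G free =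
  -- The factor `n` in `kővári-sós-turán` is cancelled; it is positive because `suc k ≤ n`.
  *-cancelʳ-≤ _ _ n {{>-nonZero (≤-trans (≤-trans (s≤s z≤n) (m≤n+m (suc k) v)) v+t≤n)}} (begin
    size G ^ suc k * n
      ≤⟨ *-monoˡ-≤ n (^-monoˡ-≤ (suc k) (size≤∑degrees G)) ⟩
    ∑ E (λ e → count (joined? G e) (allFin n)) ^ suc k * n
      ≤⟨ kővári-sós-turán (joined? G) E k (m * n ^ d) (few-common-links H disjoint v+t≤n G free) ⟩
    length E ^ k * ((m * n ^ d * n + suc k * suc k * length E) * n ^ suc k)
      ≤⟨ *-mono-≤ (^-monoˡ-≤ k ∣E∣) (*-monoˡ-≤ (n ^ suc k)
           (+-monoʳ-≤ (m * n ^ d * n) (*-monoʳ-≤ (suc k * suc k) ∣E∣))) ⟩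
    (n ^ suc d) ^ k * ((m * n ^ d * n + suc k * suc k * n ^ suc d) * n ^ suc k)
      ≡⟨ cong (_* ((m * n ^ d * n + suc k * suc k * n ^ suc d) * n ^ suc k)) (^-*-assoc n (suc d) k) ⟩
    n ^ (suc d * k) * ((m * n ^ d * n + suc k * suc k * (n * n ^ d)) * (n * n ^ k))
      ≡⟨ collect (n ^ (suc d * k)) m (n ^ d) n (suc k * suc k) (n ^ k) ⟩
    (m + suc k * suc k) * (n ^ k * (n ^ suc d * n ^ (suc d * k))) * n
      ≡⟨ cong (λ p → (m + suc k * suc k) * p * n) exponents ⟨
    (m + suc k * suc k) * n ^ (k + suc d * suc k) * n ∎)
  where
  open ≤-Reasoning
  E = shadow G
  m = suc k + size H * suc d
  ∣E∣ = uniform-length (suc d) (shadow-unique G) (shadow-uniform G)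
  collect : ∀ a m p n q r → a * ((m * p * n + q * (n * p)) * (n * r)) ≡ (m + q) * (r * (n * p * a)) * n
  collect = solve-∀
  exponents : n ^ (k + suc d * suc k) ≡ n ^ k * (n ^ suc d * n ^ (suc d * k))
  exponents = trans (^-distribˡ-+-* n k _) (cong (n ^ k *_)
    (trans (cong (n ^_) (*-suc (suc d) k)) (^-distribˡ-+-* n (suc d) (suc d * k))))

corollary2p4 : (d t : ℕ) → 1 ≤ d → 2 ≤ t →
    ∀ {v} (H : Hypergraph d v) → 2 ≤ size H → PairwiseDisjoint H →
    (λ n → ex n (K H t)) =O[n^ (suc d * t ∸ 1) / t ]
-- The exponent `suc (suc d) * t ∸ 1` computes to `k + suc d * t`, the exponent in `free-size`.
corollary2p4 (suc d) t@(suc k) _ _ {v} H _ disjoint = c , v + t , λ n v+t≤n →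
  -- Here `z≤n` settles the default value 0 of the maximum, whose power is 0 because `t` is
  -- positive.
  argmax-all (λ s → s) {P = λ s → s ^ t ≤ c ^ t * n ^ (k + suc d * t)} z≤n
    (All.map⁺ (All.tabulate λ {G} G∈ →
      ≤-trans (free-size H disjoint v+t≤n G (proj₂ (∈-filter⁻ (free? (K H t)) {xs = hypergraphs _ n} G∈)))
              (*-monoˡ-≤ _ (m≤m^suc c k))))
  where
  c = t + size H * suc d + t * t
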